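{- For every fixed positive integer $p$, $$\lim_{d\to\infty}\frac{1}{d}\cdot\frac{|B(d,p)\cap\mathbb{P}^d_\circ|}{\kappa(B(d,p)\cap\mathbb{P}^d_\circ)}=\frac{1}{p}.$$
   Context: A point of $\mathbb{Z}^d$ is primitive if its coordinates are relatively prime; $\mathbb{P}^d_\circ$ denotes the set of primitive points of $\mathbb{Z}^d$ whose first non-zero coordinate is positive. $B(d,p)=\{x\in\mathbb{R}^d:\|x\|_1\le p\}$. For a finite $\mathcal{X}\subset\mathbb{R}^d$, $\kappa(\mathcal{X})=\max_{1\le i\le d}\sum_{x\in\mathcal{X}}|x_i|$. -}

module Defs where

open import Data.Fin.Base using (Fin)
open import Data.Integer.Base as ℤ using (ℤ; +_; -[1+_]; +[1+_]; 0ℤ; 1ℤ; ∣_∣)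
open import Data.List.Base as List using (List; []; _∷_; _++_; applyUpTo; cartesianProductWith; filter; length; allFin)
open import Data.List.Extrema.Nat using (max; v≤max⁺)
open import Data.List.Membership.Propositional using (_∈_)
open import Data.List.Membership.Propositional.Properties
  using (∈-++⁺ˡ; ∈-++⁺ʳ; ∈-applyUpTo⁺; ∈-applyUpTo⁻; ∈-cartesianProductWith⁺; ∈-filter⁺; ∈-filter⁻; ∈-map⁺)
open import Data.List.Relation.Unary.All using ([])
open import Data.List.Relation.Unary.AllPairs using ([]; _∷_)
open import Data.List.Relation.Unary.Any using (here; there)
open import Data.List.Relation.Unary.Unique.Propositional using (Unique)
import Data.List.Relation.Unary.Unique.Propositional.Properties as Unique
open import Data.Nat.Base as ℕ using (ℕ; zero; suc; NonZero; _≤_; s≤s)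
open import Data.Nat.GCD using (gcd)
open import Data.Nat.ListAction using (sum)
import Data.Nat.Properties as ℕ
open import Data.Product.Base using (∃-syntax; _×_; _,_)
open import Data.Rational.Base as ℚ using (ℚ; 0ℚ)
open import Data.Sum.Base using (inj₂)
open import Data.Vec.Base as Vec using (Vec; []; _∷_; lookup; replicate)
open import Data.Vec.Properties using (∷-injective)
open import Level using (0ℓ)
open import Relation.Binary.PropositionalEquality using (_≡_; refl; cong)
open import Relation.Nullary.Decidable using (yes; no; map′; _×-dec_)
open import Relation.Unary using (Pred; Decidable; _∩_)

Primitive : ∀ {d} → Pred (Vec ℤ d) 0ℓ
Primitive x = Vec.foldr _ gcd 0 (Vec.map ∣_∣ x) ≡ 1

data FirstNonZeroPositive : ∀ {d} → Pred (Vec ℤ d) 0ℓ where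
  here  : ∀ {d n} {x : Vec ℤ d} → FirstNonZeroPositive (+[1+ n ] ∷ x)
  there : ∀ {d} {x : Vec ℤ d} → FirstNonZeroPositive x → FirstNonZeroPositive (0ℤ ∷ x)

ℙ∘ : ∀ d → Pred (Vec ℤ d) 0ℓ
ℙ∘ d = Primitive ∩ FirstNonZeroPositive

‖_‖₁ : ∀ {d} → Vec ℤ d → ℕ
‖ x ‖₁ = Vec.sum (Vec.map ∣_∣ x)

-- Only the integer points of the ball are represented, since it is only ever
-- intersected with ℙ∘ d.
B : ∀ d → ℕ → Pred (Vec ℤ d) 0ℓ
B d p x = ‖ x ‖₁ ≤ p

-- A witness that P is a finite set: its elements, each listed exactly once.
record Finite {A : Set} (P : Pred A 0ℓ) : Set where
  field
    elements : List A
    unique   : Unique elements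
    sound    : ∀ {x} → x ∈ elements → P x
    complete : ∀ {x} → P x → x ∈ elements

open Finite public

card : ∀ {A : Set} {P : Pred A 0ℓ} → Finite P → ℕ
card X = length (elements X)

coordinateSum : ∀ {d} {P : Pred (Vec ℤ d) 0ℓ} → Finite P → Fin d → ℕ
coordinateSum X i = sum (List.map (λ x → ∣ lookup x i ∣) (elements X))

-- The base value 0 only matters when d = 0, as the coordinate sums are
-- non-negative.
κ : ∀ {d} {P : Pred (Vec ℤ d) 0ℓ} → Finite P → ℕ
κ {d} X = max 0 (List.map (coordinateSum X) (allFin d))

-- A sequence of rationals indexed by the positive integers. Rational ε suffice
-- for convergence of such a sequence in ℝ to a rational limit.
Converges : ((d : ℕ) → .{{NonZero d}} → ℚ) → ℚ → Set
Converges a l = ∀ (ε : ℚ) → 0ℚ ℚ.< ε → ∃[ N ] (∀ d .{{_ : NonZero d}} → N ≤ d → ℚ.∣ a d ℚ.- l ∣ ℚ.< ε)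

firstNonZeroPositive? : ∀ {d} → Decidable (FirstNonZeroPositive {d})
firstNonZeroPositive? []             = no λ ()
firstNonZeroPositive? (+ zero ∷ x)   = map′ there (λ { (there q) → q }) (firstNonZeroPositive? x)
firstNonZeroPositive? (+[1+ n ] ∷ x) = yes here
firstNonZeroPositive? (-[1+ n ] ∷ x) = no λ ()

B∩ℙ∘? : ∀ d p → Decidable (B d p ∩ ℙ∘ d)
B∩ℙ∘? d p x = (‖ x ‖₁ ℕ.≤? p) ×-dec (_ ℕ.≟ 1) ×-dec firstNonZeroPositive? x

interval : ℕ → List ℤ
interval p = applyUpTo +_ (suc p) ++ applyUpTo -[1+_] p

interval-unique : ∀ p → Unique (interval p)
interval-unique p = Unique.++⁺
  (Unique.applyUpTo⁺₁ +_ (suc p) λ { i<j _ refl → ℕ.<-irrefl refl i<j })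
  (Unique.applyUpTo⁺₁ -[1+_] p λ { i<j _ refl → ℕ.<-irrefl refl i<j })
  disjoint
  where
  disjoint : ∀ {v} → v ∈ applyUpTo +_ (suc p) × v ∈ applyUpTo -[1+_] p → _
  disjoint (v∈₁ , v∈₂) with ∈-applyUpTo⁻ +_ v∈₁ | ∈-applyUpTo⁻ -[1+_] v∈₂
  ... | _ , _ , refl | _ , _ , ()

∈-interval : ∀ {p} k → ∣ k ∣ ≤ p → k ∈ interval p
∈-interval (+ n)    n≤p = ∈-++⁺ˡ (∈-applyUpTo⁺ +_ (s≤s n≤p))
∈-interval -[1+ n ] n<p = ∈-++⁺ʳ _ (∈-applyUpTo⁺ -[1+_] n<p)

box : ∀ d → ℕ → List (Vec ℤ d)
box zero    p = [] ∷ []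
box (suc d) p = cartesianProductWith _∷_ (interval p) (box d p)

box-unique : ∀ d p → Unique (box d p)
box-unique zero    p = [] ∷ []
box-unique (suc d) p = Unique.cartesianProductWith⁺ _∷_ ∷-injective (interval-unique p) (box-unique d p)

∈-box : ∀ {d p} (x : Vec ℤ d) → ‖ x ‖₁ ≤ p → x ∈ box d p
∈-box []      _ = here refl
∈-box (k ∷ x) h = ∈-cartesianProductWith⁺ _∷_
  (∈-interval k (ℕ.≤-trans (ℕ.m≤m+n ∣ k ∣ ‖ x ‖₁) h))
  (∈-box x (ℕ.≤-trans (ℕ.m≤n+m ‖ x ‖₁ ∣ k ∣) h))

B∩ℙ∘ : ∀ d p → Finite (B d p ∩ ℙ∘ d)
B∩ℙ∘ d p = record
  { elements = filter (B∩ℙ∘? d p) (box d p)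
  ; unique   = Unique.filter⁺ (B∩ℙ∘? d p) (box-unique d p)
  ; sound    = λ x∈ → let _ , px = ∈-filter⁻ (B∩ℙ∘? d p) {xs = box d p} x∈ in px
  ; complete = λ {x} px@(x∈B , _) → ∈-filter⁺ (B∩ℙ∘? d p) (∈-box x x∈B) px
  }

e₁ : ∀ d → Vec ℤ (suc d)
e₁ d = 1ℤ ∷ replicate d 0ℤ

e₁-∈ : ∀ d p .{{_ : NonZero p}} → (B (suc d) p ∩ ℙ∘ (suc d)) (e₁ d)
e₁-∈ d (suc p) = s≤s (ℕ.≤-trans (ℕ.≤-reflexive (norm d)) ℕ.z≤n) , cong (gcd 1) (gcds d) , here
  where
  norm : ∀ d → ‖ replicate d 0ℤ ‖₁ ≡ 0
  norm zero    = refl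
  norm (suc d) = norm d
  gcds : ∀ d → Vec.foldr _ gcd 0 (Vec.map ∣_∣ (replicate d 0ℤ)) ≡ 0
  gcds zero    = refl
  gcds (suc d) = cong (gcd 0) (gcds d)

∈⇒≤sum : ∀ {n ns} → n ∈ ns → n ≤ sum ns
∈⇒≤sum {n} (here refl)           = ℕ.m≤m+n n _
∈⇒≤sum {ns = m ∷ _} (there n∈ns) = ℕ.≤-trans (∈⇒≤sum n∈ns) (ℕ.m≤n+m _ m)

κ-nonZero : ∀ d p .{{_ : NonZero d}} .{{_ : NonZero p}} → NonZero (κ (B∩ℙ∘ d p))
κ-nonZero (suc d) p = ℕ.>-nonZero
  (v≤max⁺ 0 (List.map (coordinateSum (B∩ℙ∘ (suc d) p)) (allFin (suc d)))
    (inj₂ (here (∈⇒≤sum (∈-map⁺ (λ x → ∣ lookup x Fin.zero ∣)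
      (complete (B∩ℙ∘ (suc d) p) (e₁-∈ d p)))))))

{-# OPTIONS --safe #-}

-- Write X = B(d,p) ∩ ℙ∘. All coordinate sums of X agree, because moving a coordinate and, if
-- necessary, changing the sign of the vector permutes X; so d κ(X) = Σ_{x ∈ X} ‖x‖₁ ≤ p |X|.
-- Conversely let m be the number of x ∈ X with ‖x‖₁ < p, so that p |X| ≤ d κ(X) + p m. Replacing
-- the first coordinate of such an x by p − ‖x‖₁ whenever it vanishes defines an injection into
-- the points of X with non-zero first coordinate, hence m ≤ κ(X).
-- Together dκ(X) ≤ p |X| ≤ (d + p) κ(X), so the quotient lies between 1/p and 1/p + 1/d.
module Submission where

open import Defs
open import Algebra.Definitions using (Associative; Commutative)
open import Data.Fin.Base using (Fin; zero; suc)
open import Data.Integer.Base as ℤ using (ℤ; +_; -[1+_]; +[1+_]; 0ℤ; ∣_∣)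
import Data.Integer.Properties as ℤ
open import Data.List.Base as List using (List; []; _∷_; allFin; filter; length)
open import Data.List.Extrema.Nat using (max≤v⁺; v≤max⁺)
open import Data.List.Membership.Propositional using (_∈_)
open import Data.List.Membership.Propositional.Properties
  using (∈-∃++; ∈-filter⁻; ∈-allFin; ∈-map⁺)
open import Data.List.Properties
  using (filter-accept; filter-reject; length-tabulate; map-cong; map-tabulate)
open import Data.List.Relation.Binary.Permutation.Propositional.Properties
  using (shift; map⁺; ∈-resp-↭)
import Data.List.Relation.Unary.All as All
import Data.List.Relation.Unary.All.Properties as All
open import Data.List.Relation.Unary.AllPairs using ([]; _∷_)
import Data.List.Relation.Unary.Any as Any
open Any using (here; there)
open import Data.List.Relation.Unary.Unique.Propositional using (Unique)
import Data.List.Relation.Unary.Unique.Propositional.Properties as Unique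
open import Data.Nat.Base as ℕ using (ℕ; zero; suc; NonZero; z≤n; s≤s)
open import Data.Nat.GCD using (gcd; gcd-assoc; gcd-comm; gcd-identityˡ; gcd-zeroʳ)
open import Data.Nat.ListAction using (sum)
open import Data.Nat.ListAction.Properties using (sum-↭)
import Data.Nat.Properties as ℕ
open import Data.Nat.Tactic.RingSolver using (solve-∀)
open import Data.Product.Base using (_×_; _,_; proj₁; proj₂)
open import Data.Rational.Base as ℚ using (mkℚ; 0ℚ; _/_; _*_)
import Data.Rational.Properties as ℚ
open import Data.Rational.Unnormalised.Base as ℚᵘ using (mkℚᵘ; *≤*; *<*)
import Data.Rational.Unnormalised.Properties as ℚᵘ
open import Data.Sum.Base using (inj₂)
open import Data.Vec.Base as Vec using (Vec; []; _∷_; lookup; insertAt; removeAt)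
open import Data.Vec.Properties
  using (insertAt-lookup; insertAt-removeAt; removeAt-insertAt; map-insertAt; lookup-map;
         ∷-injectiveʳ)
open import Function.Base using (id; const; _∘_)
open import Relation.Binary.PropositionalEquality
open import Relation.Nullary using (¬_; yes; no; contradiction)

-- Sums over lists: thresholds, injections and interchange.

module _ {A : Set} where

  sum-map-mono : ∀ {f g : A → ℕ} xs → (∀ {x} → x ∈ xs → f x ℕ.≤ g x) →
                 sum (List.map f xs) ℕ.≤ sum (List.map g xs)
  sum-map-mono []       f≤g = z≤n
  sum-map-mono (x ∷ xs) f≤g = ℕ.+-mono-≤ (f≤g (here refl)) (sum-map-mono xs (f≤g ∘ there))

  sum-map-const : ∀ c (xs : List A) → sum (List.map (const c) xs) ≡ length xs ℕ.* c
  sum-map-const c []       = refl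
  sum-map-const c (x ∷ xs) = cong (c ℕ.+_) (sum-map-const c xs)

  sum-map-+ : ∀ (f g : A → ℕ) xs →
              sum (List.map (λ x → f x ℕ.+ g x) xs) ≡ sum (List.map f xs) ℕ.+ sum (List.map g xs)
  sum-map-+ f g []       = refl
  sum-map-+ f g (x ∷ xs) = trans (cong (f x ℕ.+ g x ℕ.+_) (sum-map-+ f g xs))
    (exchange (f x) (g x) (sum (List.map f xs)) (sum (List.map g xs)))
    where
    exchange : ∀ a b c d → (a ℕ.+ b) ℕ.+ (c ℕ.+ d) ≡ (a ℕ.+ c) ℕ.+ (b ℕ.+ d)
    exchange = solve-∀

  -- An entry with `f x` at least `p` is paid for by its own term of the sum, any other entry by its
  -- place in the filtered list.
  length*≤sum-map+filter : ∀ (f : A → ℕ) p xs →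
    length xs ℕ.* p ℕ.≤ sum (List.map f xs) ℕ.+ length (filter (λ x → f x ℕ.<? p) xs) ℕ.* p
  length*≤sum-map+filter f p [] = z≤n
  length*≤sum-map+filter f p (x ∷ xs) with f x ℕ.<? p
  ... | yes fx<p rewrite filter-accept (λ x → f x ℕ.<? p) {xs = xs} fx<p = begin
    p ℕ.+ length xs ℕ.* p      ≤⟨ ℕ.+-monoʳ-≤ p (length*≤sum-map+filter f p xs) ⟩
    p ℕ.+ (s ℕ.+ m)            ≤⟨ ℕ.m≤n+m _ (f x) ⟩
    f x ℕ.+ (p ℕ.+ (s ℕ.+ m))  ≡⟨ rearrange (f x) p s m ⟩
    f x ℕ.+ s ℕ.+ (p ℕ.+ m)    ∎
    where
    open ℕ.≤-Reasoning
    s = sum (List.map f xs)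
    m = length (filter (λ x → f x ℕ.<? p) xs) ℕ.* p
    rearrange : ∀ a b c d → a ℕ.+ (b ℕ.+ (c ℕ.+ d)) ≡ a ℕ.+ c ℕ.+ (b ℕ.+ d)
    rearrange = solve-∀
  ... | no ≮p rewrite filter-reject (λ x → f x ℕ.<? p) {xs = xs} ≮p =
    ℕ.≤-trans (ℕ.+-mono-≤ (ℕ.≮⇒≥ ≮p) (length*≤sum-map+filter f p xs))
              (ℕ.≤-reflexive (sym (ℕ.+-assoc (f x) _ _)))

  -- By induction on `xs`, cutting one occurrence of `φ x` out of `ys`. The images of the remaining
  -- entries survive the cut, since `φ` is injective and `x` does not occur again in `xs`.
  sum-map-injection : ∀ {C : Set} {f : A → ℕ} {g : C → ℕ} (φ : A → C) {xs ys} → Unique xs →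
    (∀ {x} → x ∈ xs → φ x ∈ ys) →
    (∀ {x y} → x ∈ xs → y ∈ xs → φ x ≡ φ y → x ≡ y) →
    (∀ {x} → x ∈ xs → f x ℕ.≤ g (φ x)) →
    sum (List.map f xs) ℕ.≤ sum (List.map g ys)
  sum-map-injection φ {[]} _ _ _ _ = z≤n
  sum-map-injection {f = f} {g} φ {x ∷ xs} (x∉xs ∷ u) into inj f≤g
    with ps , qs , refl ← ∈-∃++ (into (here refl)) = begin
      f x ℕ.+ sum (List.map f xs)
        ≤⟨ ℕ.+-mono-≤ (f≤g (here refl))
             (sum-map-injection φ u into′ (λ x∈ y∈ → inj (there x∈) (there y∈)) (f≤g ∘ there)) ⟩
      sum (List.map g (φ x ∷ ps List.++ qs))
        ≡⟨ sum-↭ (map⁺ g (shift (φ x) ps qs)) ⟨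
      sum (List.map g (ps List.++ φ x ∷ qs)) ∎
    where
    open ℕ.≤-Reasoning
    into′ : ∀ {y} → y ∈ xs → φ y ∈ ps List.++ qs
    into′ y∈ with ∈-resp-↭ (shift (φ x) ps qs) (into (there y∈))
    ... | here φy≡φx = contradiction (inj (here refl) (there y∈) (sym φy≡φx)) (All.lookup x∉xs y∈)
    ... | there φy∈  = φy∈

sum-swap : ∀ {A C : Set} (f : A → C → ℕ) xs ys →
           sum (List.map (λ x → sum (List.map (f x) ys)) xs) ≡
           sum (List.map (λ y → sum (List.map (λ x → f x y) xs)) ys)
sum-swap f []       ys = sym (trans (sum-map-const 0 ys) (ℕ.*-zeroʳ (length ys)))
sum-swap f (x ∷ xs) ys = trans (cong (sum (List.map (f x) ys) ℕ.+_) (sum-swap f xs ys))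
  (sym (sum-map-+ (f x) (λ y → sum (List.map (λ x → f x y) xs)) ys))

sum-∣lookup∣ : ∀ {d} (x : Vec ℤ d) → sum (List.map (λ i → ∣ lookup x i ∣) (allFin d)) ≡ ‖ x ‖₁
sum-∣lookup∣ []      = refl
sum-∣lookup∣ (k ∷ x) = cong (∣ k ∣ ℕ.+_) (begin
  sum (List.map (λ i → ∣ lookup (k ∷ x) i ∣) (List.tabulate suc))
    ≡⟨ cong sum (map-tabulate suc (λ i → ∣ lookup (k ∷ x) i ∣)) ⟩
  sum (List.tabulate (λ i → ∣ lookup x i ∣))
    ≡⟨ cong sum (map-tabulate id (λ i → ∣ lookup x i ∣)) ⟨
  sum (List.map (λ i → ∣ lookup x i ∣) (allFin _))
    ≡⟨ sum-∣lookup∣ x ⟩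
  ‖ x ‖₁ ∎)
  where open ≡-Reasoning

-- Sign changes.

neg : ∀ {d} → Vec ℤ d → Vec ℤ d
neg = Vec.map (λ k → ℤ.- k)

∣neg∣ : ∀ {d} (x : Vec ℤ d) → Vec.map ∣_∣ (neg x) ≡ Vec.map ∣_∣ x
∣neg∣ []      = refl
∣neg∣ (k ∷ x) = cong₂ _∷_ (ℤ.∣-i∣≡∣i∣ k) (∣neg∣ x)

neg-injective : ∀ {d} {x y : Vec ℤ d} → neg x ≡ neg y → x ≡ y
neg-injective {x = []}    {[]}    _  = refl
neg-injective {x = k ∷ x} {l ∷ y} eq =
  cong₂ _∷_ (ℤ.neg-injective (cong Vec.head eq)) (neg-injective (∷-injectiveʳ eq))

-- Leading zeros can be stripped because `gcd 0 n` is `n`, and a non-zero coordinate must turn up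
-- because the empty gcd is 0. Not being positive, it is negative.
neg-primitive : ∀ {d} {x : Vec ℤ d} → Primitive x →
                ¬ FirstNonZeroPositive x → FirstNonZeroPositive (neg x)
neg-primitive {x = []}           () _
neg-primitive {x = + zero ∷ x}   prim ¬pos =
  there (neg-primitive (trans (sym (gcd-identityˡ _)) prim) (¬pos ∘ there))
neg-primitive {x = +[1+ n ] ∷ x} _    ¬pos = contradiction here ¬pos
neg-primitive {x = -[1+ n ] ∷ x} _    _    = here

¬neg-positive : ∀ {d} {x : Vec ℤ d} → FirstNonZeroPositive x → ¬ FirstNonZeroPositive (neg x)
¬neg-positive here      ()
¬neg-positive (there q) (there r) = ¬neg-positive q r

-- For primitive `x`, this is the representative of the pair `x`, `neg x` that lies in `ℙ∘`.
normalise : ∀ {d} → Vec ℤ d → Vec ℤ d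
normalise x with firstNonZeroPositive? x
... | yes _ = x
... | no  _ = neg x

∣normalise∣ : ∀ {d} (x : Vec ℤ d) → Vec.map ∣_∣ (normalise x) ≡ Vec.map ∣_∣ x
∣normalise∣ x with firstNonZeroPositive? x
... | yes _ = refl
... | no  _ = ∣neg∣ x

normalise-positive : ∀ {d} {x : Vec ℤ d} → Primitive x → FirstNonZeroPositive (normalise x)
normalise-positive {x = x} prim with firstNonZeroPositive? x
... | yes pos  = pos
... | no  ¬pos = neg-primitive prim ¬pos

-- Moving a coordinate to another position.

move : ∀ {A : Set} {d} → Fin (suc d) → Fin (suc d) → Vec A (suc d) → Vec A (suc d)
move i j x = insertAt (removeAt x i) j (lookup x i)

move-inverse : ∀ {A : Set} {d} i j (x : Vec A (suc d)) → move j i (move i j x) ≡ x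
move-inverse i j x = begin
  insertAt (removeAt (move i j x) j) i (lookup (move i j x) j)
    ≡⟨ cong₂ (λ y k → insertAt y i k) (removeAt-insertAt (removeAt x i) j (lookup x i))
                                      (insertAt-lookup (removeAt x i) j (lookup x i)) ⟩
  insertAt (removeAt x i) i (lookup x i)
    ≡⟨ insertAt-removeAt x i ⟩
  x ∎
  where open ≡-Reasoning

map-move : ∀ {A C : Set} {d} (f : A → C) i j (x : Vec A (suc d)) →
           Vec.map f (move i j x) ≡ move i j (Vec.map f x)
map-move f i j x = trans (map-insertAt f (lookup x i) (removeAt x i) j)
  (cong₂ (λ y k → insertAt y j k) (map-removeAt x i) (sym (lookup-map i f x)))
  where
  map-removeAt : ∀ {d} x (i : Fin (suc d)) → Vec.map f (removeAt x i) ≡ removeAt (Vec.map f x) i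
  map-removeAt (k ∷ x)     zero    = refl
  map-removeAt (k ∷ l ∷ x) (suc i) = cong (f k ∷_) (map-removeAt (l ∷ x) i)

module _ {_∙_ : ℕ → ℕ → ℕ} (assoc : Associative _≡_ _∙_) (comm : Commutative _≡_ _∙_) (e : ℕ) where

  private
    fold : ∀ {d} → Vec ℕ d → ℕ
    fold = Vec.foldr (λ _ → ℕ) _∙_ e

  -- The new entry commutes past the entries in front of it. The operation is kept general to serve
  -- both the norm, with `+`, and primitivity, with `gcd`.
  foldr-insertAt : ∀ {d} (x : Vec ℕ d) i k → fold (insertAt x i k) ≡ k ∙ fold x
  foldr-insertAt x       zero    k = refl
  foldr-insertAt (l ∷ x) (suc i) k = begin
    l ∙ fold (insertAt x i k)  ≡⟨ cong (l ∙_) (foldr-insertAt x i k) ⟩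
    l ∙ (k ∙ fold x)           ≡⟨ assoc l k _ ⟨
    (l ∙ k) ∙ fold x           ≡⟨ cong (_∙ fold x) (comm l k) ⟩
    (k ∙ l) ∙ fold x           ≡⟨ assoc k l _ ⟩
    k ∙ (l ∙ fold x)           ∎
    where open ≡-Reasoning

  -- Both vectors arise by inserting the same entry into `removeAt x i`, only at different
  -- positions.
  foldr-move : ∀ {d} i j (x : Vec ℕ (suc d)) → fold (move i j x) ≡ fold x
  foldr-move i j x = begin
    fold (move i j x)                               ≡⟨ foldr-insertAt (removeAt x i) j _ ⟩
    lookup x i ∙ fold (removeAt x i)                ≡⟨ foldr-insertAt (removeAt x i) i _ ⟨
    fold (insertAt (removeAt x i) i (lookup x i))   ≡⟨ cong fold (insertAt-removeAt x i) ⟩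
    fold x                                          ∎
    where open ≡-Reasoning

∣lookup∣ : ∀ {d} {x y : Vec ℤ d} i → Vec.map ∣_∣ x ≡ Vec.map ∣_∣ y → ∣ lookup x i ∣ ≡ ∣ lookup y i ∣
∣lookup∣ {x = x} {y} i eq =
  trans (sym (lookup-map i ∣_∣ x)) (trans (cong (λ z → lookup z i) eq) (lookup-map i ∣_∣ y))

move-injective : ∀ {A : Set} {d} i j {x y : Vec A (suc d)} → move i j x ≡ move i j y → x ≡ y
move-injective i j {x} {y} eq =
  trans (sym (move-inverse i j x)) (trans (cong (move j i) eq) (move-inverse i j y))

-- Negation commutes with `move`, so equality would force `x` to be `neg y`; but `y` and `neg y`
-- cannot both be positive.
move-≢-neg : ∀ {d} i j {x y : Vec ℤ (suc d)} → FirstNonZeroPositive x → FirstNonZeroPositive y →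
             move i j x ≢ neg (move i j y)
move-≢-neg i j {y = y} x>0 y>0 eq = ¬neg-positive y>0 (subst FirstNonZeroPositive
  (move-injective i j (trans eq (map-move (λ k → ℤ.- k) i j y))) x>0)

-- If both moved vectors are kept or both are negated, the operations cancel; the mixed cases are
-- those excluded by `move-≢-neg`.
normalise-move-injective : ∀ {d} i j {x y : Vec ℤ (suc d)} →
  FirstNonZeroPositive x → FirstNonZeroPositive y →
  normalise (move i j x) ≡ normalise (move i j y) → x ≡ y
normalise-move-injective i j {x} {y} x>0 y>0 eq
  with firstNonZeroPositive? (move i j x) | firstNonZeroPositive? (move i j y)
... | yes _ | yes _ = move-injective i j eq
... | no  _ | no  _ = move-injective i j (neg-injective eq)
... | yes _ | no  _ = contradiction eq (move-≢-neg i j x>0 y>0)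
... | no  _ | yes _ = contradiction (sym eq) (move-≢-neg i j y>0 x>0)

-- Filling up points of norm below `p`.

-- Junk value: for ‖ x ‖₁ > p the new coordinate is p ∸ ‖ x ‖₁ = 0.
fill : ∀ {d} → ℕ → Vec ℤ (suc d) → Vec ℤ (suc d)
fill p (+ zero ∷ x)   = + (p ℕ.∸ ‖ x ‖₁) ∷ x
fill p (+[1+ n ] ∷ x) = +[1+ n ] ∷ x
fill p (-[1+ n ] ∷ x) = -[1+ n ] ∷ x

-- A vector whose zero head was replaced now has norm exactly `p`, whereas an unchanged one still
-- has norm below `p`, so the two kinds never collide. Within the first kind the tail determines the
-- vector.
fill-injective : ∀ {d} p {x y : Vec ℤ (suc d)} → ‖ x ‖₁ ℕ.< p → ‖ y ‖₁ ℕ.< p →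
                 fill p x ≡ fill p y → x ≡ y
fill-injective p {+ zero ∷ x}   {+ zero ∷ y}   _  _  eq = cong (0ℤ ∷_) (∷-injectiveʳ eq)
fill-injective p {+ zero ∷ x}   {+[1+ n ] ∷ y} x< y< eq
  with refl ← ∷-injectiveʳ eq =
  contradiction (trans (cong (λ k → k ℕ.+ ‖ x ‖₁) (sym (ℤ.+-injective (cong Vec.head eq))))
                       (ℕ.m∸n+n≡m (ℕ.<⇒≤ x<))) (ℕ.<⇒≢ y<)
fill-injective p {+ zero ∷ x}   { -[1+ n ] ∷ y} _ _ eq with () ← cong Vec.head eq
fill-injective p {+[1+ n ] ∷ x} {+ zero ∷ y}   x< y< eq
  with refl ← ∷-injectiveʳ eq =
  contradiction (trans (cong (λ k → k ℕ.+ ‖ x ‖₁) (ℤ.+-injective (cong Vec.head eq)))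
                       (ℕ.m∸n+n≡m (ℕ.<⇒≤ y<))) (ℕ.<⇒≢ x<)
fill-injective p {+[1+ n ] ∷ x} {+[1+ m ] ∷ y} _  _  eq = eq
fill-injective p {+[1+ n ] ∷ x} { -[1+ m ] ∷ y} _ _  eq = eq
fill-injective p { -[1+ n ] ∷ x} {+ zero ∷ y}   _ _ eq with () ← cong Vec.head eq
fill-injective p { -[1+ n ] ∷ x} {+[1+ m ] ∷ y} _ _ eq = eq
fill-injective p { -[1+ n ] ∷ x} { -[1+ m ] ∷ y} _ _ eq = eq

fill-head : ∀ {d} p (x : Vec ℤ (suc d)) → ‖ x ‖₁ ℕ.< p → 1 ℕ.≤ ∣ lookup (fill p x) zero ∣
fill-head p (+ zero ∷ x)   x< = ℕ.m<n⇒0<n∸m x<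
fill-head p (+[1+ n ] ∷ x) _  = s≤s z≤n
fill-head p (-[1+ n ] ∷ x) _  = s≤s z≤n

-- When the head is 0, the tail alone has gcd 1, so any new head preserves primitivity. The one
-- chosen is positive and raises the norm to exactly `p`.
fill-∈ : ∀ {d} p (x : Vec ℤ (suc d)) → ‖ x ‖₁ ℕ.< p →
         B (suc d) p x × ℙ∘ (suc d) x → B (suc d) p (fill p x) × ℙ∘ (suc d) (fill p x)
fill-∈ p (+ zero ∷ x) x< (_ , prim , _) =
  ℕ.≤-reflexive (ℕ.m∸n+n≡m (ℕ.<⇒≤ x<)) ,
  trans (cong (gcd (p ℕ.∸ ‖ x ‖₁)) (trans (sym (gcd-identityˡ _)) prim))
        (gcd-zeroʳ (p ℕ.∸ ‖ x ‖₁)) ,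
  positive (ℕ.m<n⇒0<n∸m x<)
  where
  positive : ∀ {n} → 0 ℕ.< n → FirstNonZeroPositive (+ n ∷ x)
  positive (s≤s _) = here
fill-∈ p (+[1+ n ] ∷ x) _ x∈ = x∈
fill-∈ p (-[1+ n ] ∷ x) _ x∈ = x∈

-- Bounds relating `card` and `κ` in dimension `suc d`.

module _ (d p : ℕ) where

  private
    X  = B∩ℙ∘ (suc d) p
    xs = elements X
    S  = coordinateSum X

  -- The map `φ` injects `X` into itself and carries the absolute value of coordinate `i` to
  -- coordinate `j`. As `i` and `j` are arbitrary, all coordinate sums are equal.
  coordinateSum-≤ : ∀ i j → S i ℕ.≤ S j
  coordinateSum-≤ i j = sum-map-injection φ (unique X)
    (λ x∈ → complete X (φ-∈ (sound X x∈)))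
    (λ x∈ y∈ → normalise-move-injective i j (positive x∈) (positive y∈))
    (λ {x} _ → ℕ.≤-reflexive (sym (trans (∣lookup∣ j (∣normalise∣ (move i j x)))
      (cong ∣_∣ (insertAt-lookup (removeAt x i) j (lookup x i))))))
    where
    φ : Vec ℤ (suc d) → Vec ℤ (suc d)
    φ x = normalise (move i j x)
    fold-move : ∀ {_∙_} → Associative _≡_ _∙_ → Commutative _≡_ _∙_ → ∀ x →
             Vec.foldr (λ _ → ℕ) _∙_ 0 (Vec.map ∣_∣ (move i j x)) ≡
             Vec.foldr (λ _ → ℕ) _∙_ 0 (Vec.map ∣_∣ x)
    fold-move assoc comm x = trans (cong (Vec.foldr _ _ 0) (map-move ∣_∣ i j x))
                                (foldr-move assoc comm 0 i j (Vec.map ∣_∣ x))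
    φ-∈ : ∀ {x} → B (suc d) p x × ℙ∘ (suc d) x → B (suc d) p (φ x) × ℙ∘ (suc d) (φ x)
    φ-∈ {x} (x≤p , prim , _) =
      ℕ.≤-trans (ℕ.≤-reflexive (trans (cong Vec.sum ∣φx∣) (fold-move ℕ.+-assoc ℕ.+-comm x))) x≤p ,
      trans (cong (Vec.foldr (λ _ → ℕ) gcd 0) ∣φx∣) prim′ ,
      normalise-positive {x = move i j x} prim′
      where
      ∣φx∣  = ∣normalise∣ (move i j x)
      prim′ = trans (fold-move gcd-assoc gcd-comm x) prim
    positive : ∀ {x} → x ∈ xs → FirstNonZeroPositive x
    positive x∈ = proj₂ (proj₂ (sound X x∈))

  coordinateSum≤κ : ∀ i → S i ℕ.≤ κ X
  coordinateSum≤κ i = v≤max⁺ 0 _ (inj₂ (Any.map ℕ.≤-reflexive (∈-map⁺ S (∈-allFin i))))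

  κ≤coordinateSum : ∀ i → κ X ℕ.≤ S i
  -- Here `z≤n` disposes of the base value 0 of the maximum.
  κ≤coordinateSum i = max≤v⁺ z≤n
    (All.map⁺ (All.universal (λ j → coordinateSum-≤ j i) (allFin (suc d))))

  -- Double counting, by coordinates and by points.
  sum-coordinateSum : sum (List.map S (allFin (suc d))) ≡ sum (List.map ‖_‖₁ xs)
  sum-coordinateSum = trans (sum-swap (λ i x → ∣ lookup x i ∣) (allFin (suc d)) xs)
    (cong sum (map-cong sum-∣lookup∣ xs))

  sum-const : ∀ c → sum (List.map (const c) (allFin (suc d))) ≡ suc d ℕ.* c
  sum-const c = trans (sum-map-const c (allFin (suc d)))
    (cong (ℕ._* c) (length-tabulate {n = suc d} id))

  d*κ≤card*p : suc d ℕ.* κ X ℕ.≤ card X ℕ.* p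
  d*κ≤card*p = begin
    suc d ℕ.* κ X                                  ≡⟨ sum-const (κ X) ⟨
    sum (List.map (const (κ X)) (allFin (suc d)))  ≤⟨ sum-map-mono (allFin _) (λ {i} _ → κ≤coordinateSum i) ⟩
    sum (List.map S (allFin (suc d)))              ≡⟨ sum-coordinateSum ⟩
    sum (List.map ‖_‖₁ xs)                         ≤⟨ sum-map-mono xs (proj₁ ∘ sound X) ⟩
    sum (List.map (const p) xs)                    ≡⟨ sum-map-const p xs ⟩
    card X ℕ.* p                                   ∎
    where open ℕ.≤-Reasoning

  -- Each interior point counts 1, and its image under `fill p` contributes at least 1 to `S zero`.
  interior≤κ : length (filter (λ x → ‖ x ‖₁ ℕ.<? p) xs) ℕ.≤ κ X
  interior≤κ = begin
    length ys                    ≡⟨ ℕ.*-identityʳ _ ⟨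
    length ys ℕ.* 1              ≡⟨ sum-map-const 1 ys ⟨
    sum (List.map (const 1) ys)  ≤⟨ sum-map-injection (fill p) (Unique.filter⁺ _<p? (unique X))
                                      (λ {x} x∈ → let x∈X , x< = ∈-filter⁻ _<p? {xs = xs} x∈ in
                                         complete X (fill-∈ p x x< (sound X x∈X)))
                                      (λ x∈ y∈ → fill-injective p (<p x∈) (<p y∈))
                                      (λ {x} x∈ → fill-head p x (<p x∈)) ⟩
    S zero                       ≤⟨ coordinateSum≤κ zero ⟩
    κ X                          ∎
    where
    open ℕ.≤-Reasoning
    _<p? = λ (x : Vec ℤ (suc d)) → ‖ x ‖₁ ℕ.<? p
    ys = filter _<p? xs
    <p : ∀ {x} → x ∈ ys → ‖ x ‖₁ ℕ.< p
    <p x∈ = proj₂ (∈-filter⁻ _<p? {xs = xs} x∈)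

  card*p≤[d+p]*κ : card X ℕ.* p ℕ.≤ (suc d ℕ.+ p) ℕ.* κ X
  card*p≤[d+p]*κ = begin
    card X ℕ.* p                                    ≤⟨ length*≤sum-map+filter ‖_‖₁ p xs ⟩
    -- The `m` points of norm below `p` are charged `p` each.
    sum (List.map ‖_‖₁ xs) ℕ.+ m ℕ.* p              ≤⟨ ℕ.+-mono-≤ norms (ℕ.*-monoˡ-≤ p interior≤κ) ⟩
    suc d ℕ.* κ X ℕ.+ κ X ℕ.* p                     ≡⟨ collect (suc d) p (κ X) ⟩
    (suc d ℕ.+ p) ℕ.* κ X                           ∎
    where
    open ℕ.≤-Reasoning
    m = length (filter (λ x → ‖ x ‖₁ ℕ.<? p) xs)
    collect : ∀ d p k → d ℕ.* k ℕ.+ k ℕ.* p ≡ (d ℕ.+ p) ℕ.* k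
    collect = solve-∀
    norms : sum (List.map ‖_‖₁ xs) ℕ.≤ suc d ℕ.* κ X
    norms = begin
      sum (List.map ‖_‖₁ xs)                         ≡⟨ sum-coordinateSum ⟨
      sum (List.map S (allFin (suc d)))              ≤⟨ sum-map-mono (allFin _) (λ {i} _ → coordinateSum≤κ i) ⟩
      sum (List.map (const (κ X)) (allFin (suc d)))  ≡⟨ sum-const (κ X) ⟩
      suc d ℕ.* κ X                                  ∎

-- From the integer bounds to the limit.

∣1/d*m/k-1/p∣≤1/d : ∀ d p m k .{{_ : NonZero d}} .{{_ : NonZero p}} .{{k≢0 : NonZero k}} →
  d ℕ.* k ℕ.≤ m ℕ.* p → m ℕ.* p ℕ.≤ (d ℕ.+ p) ℕ.* k →
  ℚ.∣ (+ 1 / d) * (+ m / k) ℚ.- + 1 / p ∣ ℚ.≤ + 1 / d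
∣1/d*m/k-1/p∣≤1/d d@(suc d-1) p@(suc p-1) m k@(suc k-1) lower upper = begin
  ℚ.∣ r ℚ.- l ∣        ≡⟨ ℚ.0≤p⇒∣p∣≡p 0≤r-l ⟩
  r ℚ.- l              ≤⟨ ℚ.+-monoˡ-≤ (ℚ.- l) r≤e+l ⟩
  (e ℚ.+ l) ℚ.- l      ≡⟨ ℚ.+-assoc e l (ℚ.- l) ⟩
  e ℚ.+ (l ℚ.- l)      ≡⟨ cong (e ℚ.+_) (ℚ.+-inverseʳ l) ⟩
  e ℚ.+ 0ℚ             ≡⟨ ℚ.+-identityʳ e ⟩
  e                    ∎
  where
  open ℚ.≤-Reasoning
  e = + 1 / d
  l = + 1 / p
  r = e * (+ m / k)
  -- On unnormalised fractions the order is plain cross-multiplication.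
  eᵘ = mkℚᵘ (+ 1) d-1
  lᵘ = mkℚᵘ (+ 1) p-1
  rᵘ = eᵘ ℚᵘ.* mkℚᵘ (+ m) k-1

  r≃ : ℚ.toℚᵘ r ℚᵘ.≃ rᵘ
  r≃ = ℚᵘ.≃-trans (ℚ.toℚᵘ-homo-* e (+ m / k))
         (ℚᵘ.*-cong (ℚ.toℚᵘ-fromℚᵘ eᵘ) (ℚ.toℚᵘ-fromℚᵘ (mkℚᵘ (+ m) k-1)))

  e+l≃ : ℚ.toℚᵘ (e ℚ.+ l) ℚᵘ.≃ eᵘ ℚᵘ.+ lᵘ
  e+l≃ = ℚᵘ.≃-trans (ℚ.toℚᵘ-homo-+ e l) (ℚᵘ.+-cong (ℚ.toℚᵘ-fromℚᵘ eᵘ) (ℚ.toℚᵘ-fromℚᵘ lᵘ))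

  lᵘ≤rᵘ : lᵘ ℚᵘ.≤ rᵘ
  -- Cross-multiplying 1/p ≤ m/(dk) gives exactly `lower`.
  lᵘ≤rᵘ = *≤* (subst₂ ℤ._≤_ (sym (ℤ.*-identityˡ _))
    (trans (ℤ.pos-* m p) (cong (ℤ._* + p) (sym (ℤ.*-identityˡ (+ m))))) (ℤ.+≤+ lower))

  rᵘ≤eᵘ+lᵘ : rᵘ ℚᵘ.≤ eᵘ ℚᵘ.+ lᵘ
  -- The sum 1/d + 1/p has the unreduced form (p + d)/(dp), so cross-multiplication gives `upper`
  -- multiplied by `d`.
  rᵘ≤eᵘ+lᵘ = *≤* (subst₂ ℤ._≤_
    (trans (ℤ.pos-* m (d ℕ.* p)) (cong (ℤ._* + (d ℕ.* p)) (sym (ℤ.*-identityˡ (+ m)))))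
    (trans (ℤ.pos-* (p ℕ.+ d) (d ℕ.* k)) (cong (ℤ._* + (d ℕ.* k))
       (cong₂ ℤ._+_ (sym (ℤ.*-identityˡ (+ p))) (sym (ℤ.*-identityˡ (+ d))))))
    (ℤ.+≤+ (subst₂ ℕ._≤_ (left d p m) (right d p k) (ℕ.*-monoʳ-≤ d upper))))
    where
    left : ∀ d p m → d ℕ.* (m ℕ.* p) ≡ m ℕ.* (d ℕ.* p)
    left = solve-∀
    right : ∀ d p k → d ℕ.* ((d ℕ.+ p) ℕ.* k) ≡ (p ℕ.+ d) ℕ.* (d ℕ.* k)
    right = solve-∀

  l≤r : l ℚ.≤ r
  l≤r = ℚ.toℚᵘ-cancel-≤
    (ℚᵘ.≤-respˡ-≃ (ℚᵘ.≃-sym (ℚ.toℚᵘ-fromℚᵘ lᵘ)) (ℚᵘ.≤-respʳ-≃ (ℚᵘ.≃-sym r≃) lᵘ≤rᵘ))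

  0≤r-l : 0ℚ ℚ.≤ r ℚ.- l
  0≤r-l = subst (ℚ._≤ r ℚ.- l) (ℚ.+-inverseʳ l) (ℚ.+-monoˡ-≤ (ℚ.- l) l≤r)

  r≤e+l : r ℚ.≤ e ℚ.+ l
  r≤e+l = ℚ.toℚᵘ-cancel-≤
    (ℚᵘ.≤-respˡ-≃ (ℚᵘ.≃-sym r≃) (ℚᵘ.≤-respʳ-≃ (ℚᵘ.≃-sym e+l≃) rᵘ≤eᵘ+lᵘ))

-- A positive `ε` has numerator at least 1, so it is at least the reciprocal of its denominator,
-- which exceeds 1/d.
1/d<ε : ∀ ε → 0ℚ ℚ.< ε → ∀ d .{{_ : NonZero d}} → ℚ.↧ₙ ε ℕ.< d → + 1 / d ℚ.< ε
1/d<ε (mkℚ (+ zero)   _   _) (ℚ.*<* (ℤ.+<+ ()))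
1/d<ε (mkℚ -[1+ _ ]   _   _) (ℚ.*<* ())
1/d<ε (mkℚ +[1+ n ] b-1 _) _ d@(suc d-1) b<d = ℚ.toℚᵘ-cancel-<
  (ℚᵘ.<-respˡ-≃ (ℚᵘ.≃-sym (ℚ.toℚᵘ-fromℚᵘ (mkℚᵘ (+ 1) d-1)))
    (*<* (subst₂ ℤ._<_ (sym (ℤ.*-identityˡ (+ suc b-1))) (ℤ.pos-* (suc n) d)
      (ℤ.+<+ (ℕ.<-≤-trans b<d (ℕ.m≤m+n d (n ℕ.* d)))))))

theorem7p4 : ∀ (p : ℕ) .{{_ : NonZero p}} →
    Converges
    (λ d → (+ 1 / d) * _/_ (+ card (B∩ℙ∘ d p)) (κ (B∩ℙ∘ d p)) {{κ-nonZero d p}})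
    (+ 1 / p)
-- With this threshold, `N≤d` is the strict inequality `ℚ.↧ₙ ε ℕ.< d` that `1/d<ε` requires.
theorem7p4 p ε ε>0 = suc (ℚ.↧ₙ ε) , λ where
  d@(suc d-1) N≤d → ℚ.≤-<-trans
    (∣1/d*m/k-1/p∣≤1/d d p (card (B∩ℙ∘ d p)) (κ (B∩ℙ∘ d p)) {{k≢0 = κ-nonZero d p}}
      (d*κ≤card*p d-1 p) (card*p≤[d+p]*κ d-1 p))
    (1/d<ε ε ε>0 d N≤d)
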